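{- Let $\{p_n(x)\}_{n\ge 0}$ be an orthogonal polynomial sequence with $[x^n]p_n(x)\neq 0$ for all $n$, satisfying the three-term recurrence $$x\,p_n(x)=\alpha_np_{n+1}(x)+\beta_np_n(x)+\gamma_np_{n-1}(x),\qquad n\ge 0,\quad p_{ -1}(x)=0,$$ and let $A=(a_{n,k})_{n,k\ge 0}$ be its coefficient matrix, $p_n(x)=\sum_{k=0}^n a_{n,k}x^k$. Then the inverse matrix $A^{ -1}$ exists, and the production matrix of $A^{ -1}$ is a tridiagonal matrix that represents the three-term recurrence of $\{p_n(x)\}$, namely the Jacobi matrix $$J=\begin{pmatrix}\beta_0&\alpha_0&0&0&\cdots\\ \gamma_1&\beta_1&\alpha_1&0&\cdots\\ 0&\gamma_2&\beta_2&\alpha_2&\cdots\\ \vdots&\vdots&\ddots&\ddots&\ddots\end{pmatrix}.$$ Furthermore, the first column of $A^{ -1}$ is the moment sequence of $\{p_n(x)\}$: if $L$ is the linear functional defining the orthogonality, normalized so that $L[p_0]=1$, then $(A^{ -1})_{n,0}=L(x^n)$ for all $n\ge 0$.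
   Context: An orthogonal polynomial sequence (OPS) is a sequence of polynomials $p_n$ with $\deg p_n=n$ for which there is a linear functional $L$ on polynomials with $L[p_mp_n]=0$ for $m\neq n$ and $L[p_n^2]\ne 0$; its moments are $\mu_k=L(x^k)$. Let $S=(\delta_{n,k-1})_{n,k\ge 0}$ be the infinite upper shift matrix (ones on the first superdiagonal, zeros elsewhere). For an invertible infinite lower triangular matrix $B$, the production matrix of $B$ is $P_B=B^{ -1}SB$; thus the production matrix of $A^{ -1}$ is $ASA^{ -1}$. -}

module Defs where

open import Level using (Level; _⊔_)
open import Algebra.Apartness.Bundles using (HeytingField; HeytingCommutativeRing)
open import Algebra.Bundles using (CommutativeRing)
open import Algebra.Module.Bundles.Raw using (RawLeftModule)
open import Algebra.Module.Morphism.Structures using (module LeftModuleMorphisms)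
import Algebra.Module.Construct.TensorUnit as TensorUnit
import Algebra.Properties.Monoid.Sum as Sum
open import Data.Bool.Base using (if_then_else_)
open import Data.Fin.Base using (Fin; zero; suc; toℕ)
open import Data.List.Base using (List; []; _∷_; length; map)
open import Data.Nat.Base as ℕ using (ℕ; zero; suc; _≤_; _<_; s≤s; _≡ᵇ_)
import Data.Nat.Properties as ℕ
open import Data.Product.Base using (_×_; ∃)
import Data.Vec.Functional as Vector
open import Function.Base using (_∘_)
open import Relation.Binary.PropositionalEquality.Core using (_≢_)
open import Relation.Nullary.Decidable using (dec-false)

private
  maximum : ∀ {n} → (Fin n → ℕ) → ℕ
  maximum = Vector.foldr ℕ._⊔_ 0

  ≤-maximum : ∀ {n} (f : Fin n → ℕ) i → f i ≤ maximum f
  ≤-maximum f zero    = ℕ.m≤m⊔n _ _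
  ≤-maximum f (suc i) = ℕ.≤-trans (≤-maximum (f ∘ suc) i) (ℕ.m≤n⊔m (f zero) _)

-- The ground field is arbitrary.  "Nonzero" is apartness from 0#, which in a
-- Heyting field is invertibility; a field with decidable equality is a
-- Heyting field whose apartness is _≉_.
module OverField {c ℓ₁ ℓ₂ : Level} (K : HeytingField c ℓ₁ ℓ₂) where

  open HeytingField K using (heytingCommutativeRing)
  open HeytingCommutativeRing heytingCommutativeRing
    using (Carrier; _≈_; _#_; commutativeRing)
  open CommutativeRing commutativeRing
    using (_+_; _*_; -_; 0#; 1#; refl; trans; zeroʳ; *-congˡ; +-monoid; rawRing)
  open Sum +-monoid using (sum-syntax; sum-cong-≋; sum-replicate-zero)

  -- c₀ ∷ c₁ ∷ … is c₀ + c₁ x + …; trailing zeros are allowed, so equality of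
  -- polynomials is the coefficientwise _≈ₚ_.
  Poly : Set c
  Poly = List Carrier

  coeff : Poly → ℕ → Carrier
  coeff []      _       = 0#
  coeff (a ∷ q) zero    = a
  coeff (a ∷ q) (suc k) = coeff q k

  infix  4 _≈ₚ_
  infixl 6 _+ₚ_
  infixr 7 _•_
  infixl 7 _*ₚ_
  infix  8 -ₚ_

  _≈ₚ_ : Poly → Poly → Set ℓ₁
  q ≈ₚ r = ∀ k → coeff q k ≈ coeff r k

  0ₚ 1ₚ X : Poly
  0ₚ = []
  1ₚ = 1# ∷ []
  X  = 0# ∷ 1# ∷ []

  _+ₚ_ : Poly → Poly → Poly
  []      +ₚ r       = r
  (a ∷ q) +ₚ []      = a ∷ q
  (a ∷ q) +ₚ (b ∷ r) = a + b ∷ q +ₚ r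

  -ₚ_ : Poly → Poly
  -ₚ_ = map -_

  _•_ : Carrier → Poly → Poly
  a • q = map (a *_) q

  _*ₚ_ : Poly → Poly → Poly
  []      *ₚ r = 0ₚ
  (a ∷ q) *ₚ r = a • r +ₚ (0# ∷ q *ₚ r)

  X^_ : ℕ → Poly
  X^ zero    = 1ₚ
  X^ (suc n) = X *ₚ X^ n

  HasDegree : Poly → ℕ → Set (ℓ₁ ⊔ ℓ₂)
  HasDegree q n = (coeff q n # 0#) × (∀ k → n < k → coeff q k ≈ 0#)

  polyRawLeftModule : RawLeftModule Carrier c ℓ₁
  polyRawLeftModule = record
    { _≈ᴹ_ = _≈ₚ_
    ; _+ᴹ_ = _+ₚ_
    ; _*ₗ_ = _•_
    ; 0ᴹ   = 0ₚ
    ; -ᴹ_  = -ₚ_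
    }

  IsLinearFunctional : (Poly → Carrier) → Set (c ⊔ ℓ₁)
  IsLinearFunctional = IsLeftModuleHomomorphism
    where open LeftModuleMorphisms polyRawLeftModule
                                   (TensorUnit.rawLeftModule {R = rawRing})

  record IsOrthogonalWrt (L : Poly → Carrier) (p : ℕ → Poly) : Set (c ⊔ ℓ₁ ⊔ ℓ₂) where
    field
      linear     : IsLinearFunctional L
      orthogonal : ∀ m n → m ≢ n → L (p m *ₚ p n) ≈ 0#
      nonzero    : ∀ n → L (p n *ₚ p n) # 0#

  record IsOPS (p : ℕ → Poly) : Set (c ⊔ ℓ₁ ⊔ ℓ₂) where
    field
      degree     : ∀ n → HasDegree (p n) n
      functional : ∃ λ L → IsOrthogonalWrt L p

  moment : (Poly → Carrier) → ℕ → Carrier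
  moment L k = L (X^ k)

  -- pred p n is p_{n-1}, with p_{-1} = 0.
  pred : (ℕ → Poly) → ℕ → Poly
  pred p zero    = 0ₚ
  pred p (suc n) = p n

  ThreeTermRecurrence : (α β γ : ℕ → Carrier) → (ℕ → Poly) → Set ℓ₁
  ThreeTermRecurrence α β γ p = ∀ n →
    X *ₚ p n ≈ₚ α n • p (suc n) +ₚ β n • p n +ₚ γ n • pred p n

  -- Infinite matrices with finitely many nonzero entries in each row; these
  -- include all lower triangular matrices and the shift, and their products
  -- are finite sums.  The bound `width` is not part of matrix equality, and
  -- the product does not depend on it up to _≈ᴹ_.
  record Matrix : Set (c ⊔ ℓ₁) where
    field
      entry    : ℕ → ℕ → Carrier
      width    : ℕ → ℕ
      vanishes : ∀ n k → width n ≤ k → entry n k ≈ 0#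

  open Matrix public

  infix  4 _≈ᴹ_
  infixr 7 _·_

  _≈ᴹ_ : Matrix → Matrix → Set ℓ₁
  M ≈ᴹ N = ∀ n k → entry M n k ≈ entry N n k

  _·_ : Matrix → Matrix → Matrix
  entry (M · N) n k = ∑[ j < width M n ] (entry M n (toℕ j) * entry N (toℕ j) k)
  width (M · N) n   = maximum {width M n} λ j → width N (toℕ j)
  vanishes (M · N) n k w≤k = trans
    (sum-cong-≋ {width M n} λ j → trans
      (*-congˡ (vanishes N (toℕ j) k (ℕ.≤-trans (≤-maximum (width N ∘ toℕ) j) w≤k)))
      (zeroʳ _))
    (sum-replicate-zero (width M n))

  private
    ≡ᵇ-false : ∀ {m n} {x y : Carrier} → m ≢ n → y ≈ 0# →
               (if m ≡ᵇ n then x else y) ≈ 0#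
    ≡ᵇ-false {m} {n} m≢n y≈0 rewrite dec-false (m ℕ.≟ n) m≢n = y≈0

  identity : Matrix
  entry identity n k = if k ≡ᵇ n then 1# else 0#
  width identity n   = suc n
  vanishes identity n k n<k = ≡ᵇ-false (ℕ.>⇒≢ n<k) refl

  shift : Matrix
  entry shift n k = if k ≡ᵇ suc n then 1# else 0#
  width shift n   = suc (suc n)
  vanishes shift n k n<k = ≡ᵇ-false (ℕ.>⇒≢ n<k) refl

  -- γ 0 does not occur, since suc k ≡ᵇ 0 is false.
  jacobi : (α β γ : ℕ → Carrier) → Matrix
  entry (jacobi α β γ) n k =
    if k ≡ᵇ suc n then α n else
    if k ≡ᵇ n     then β n else
    if suc k ≡ᵇ n then γ n else 0#
  width (jacobi α β γ) n = suc (suc n)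
  vanishes (jacobi α β γ) n k 1+n<k =
    ≡ᵇ-false (ℕ.>⇒≢ 1+n<k)
      (≡ᵇ-false (ℕ.>⇒≢ n<k)
        (≡ᵇ-false {suc k} {n} (ℕ.>⇒≢ (ℕ.m<n⇒m<1+n n<k)) refl))
    where n<k = ℕ.<-trans (ℕ.n<1+n n) 1+n<k

  coefficientMatrix : (ℕ → Poly) → Matrix
  entry (coefficientMatrix p) n = coeff (p n)
  width (coefficientMatrix p) n = length (p n)
  vanishes (coefficientMatrix p) n k = beyond (p n) k
    where
    beyond : ∀ q k → length q ≤ k → coeff q k ≈ 0#
    beyond []      _       _         = refl
    beyond (a ∷ q) (suc k) (s≤s l≤k) = beyond q k l≤k

  LowerTriangular : Matrix → Set ℓ₁
  LowerTriangular M = ∀ n k → n < k → entry M n k ≈ 0#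

  record InvertibleLowerTriangular (B : Matrix) : Set (c ⊔ ℓ₁) where
    field
      lowerTriangular         : LowerTriangular B
      inverse                 : Matrix
      inverse-lowerTriangular : LowerTriangular inverse
      inverseˡ                : inverse · B ≈ᴹ identity
      inverseʳ                : B · inverse ≈ᴹ identity

  open InvertibleLowerTriangular public using (inverse)

  inverse-invertible : ∀ {B} (B⁻¹ : InvertibleLowerTriangular B) →
                       InvertibleLowerTriangular (inverse B⁻¹)
  inverse-invertible {B} B⁻¹ = record
    { lowerTriangular         = inverse-lowerTriangular
    ; inverse                 = B
    ; inverse-lowerTriangular = lowerTriangular
    ; inverseˡ                = inverseʳ
    ; inverseʳ                = inverseˡ
    } where open InvertibleLowerTriangular B⁻¹ using
              (lowerTriangular; inverse-lowerTriangular; inverseˡ; inverseʳ)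

  productionMatrix : ∀ {B} → InvertibleLowerTriangular B → Matrix
  productionMatrix {B} B⁻¹ = inverse B⁻¹ · shift · B

{-# OPTIONS --safe #-}

-- The recurrence says A S = J A, so A S A⁻¹ = J A A⁻¹ = J.  For the existence
-- of A⁻¹ only a₀₀ has to be inverted explicitly: the rows of the matrix B
-- expanding xⁿ in the basis p must satisfy B₀ = a₀₀⁻¹ e₀ and Bₙ₊₁ = Bₙ J,
-- which we take as the definition of B.  Then S B = B J, whence B A commutes
-- with S and A B commutes with J; both have first row e₀, and a matrix
-- commuting with J is determined by its first row because every αₙ is
-- invertible (αₙ aₙ₊₁,ₙ₊₁ = aₙₙ).  Finally xⁿ = Σ (A⁻¹)ₙₖ pₖ, and L kills pₖ for
-- k > 0 since p₀ is a nonzero constant, so L(xⁿ) = (A⁻¹)ₙ₀ L(p₀).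

module Submission where

open import Defs
open import Algebra.Apartness.Bundles using (HeytingField; HeytingCommutativeRing)
open import Algebra.Bundles using (CommutativeRing)
import Algebra.Apartness.Properties.HeytingCommutativeRing as HeytingCommutativeRingProperties
import Algebra.Definitions as AlgebraDefinitions
import Algebra.Module.Construct.TensorUnit as TensorUnit
open import Algebra.Module.Morphism.Structures using (module LeftModuleMorphisms)
import Algebra.Properties.CommutativeMonoid.Sum as CommutativeMonoidSum
import Algebra.Properties.Group as GroupProperties
import Algebra.Properties.Semiring.Sum as SemiringSum
open import Data.Fin.Base using (Fin; zero; suc; toℕ)
open import Data.Fin.Properties using (toℕ<n)
open import Data.List.Base using ([]; _∷_)
open import Data.Nat.Base as ℕ using (ℕ; zero; suc; _≤_; z≤n; s≤s)
import Data.Nat.Properties as ℕ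
open import Data.Product.Base using (_×_; _,_; proj₁; proj₂)
import Data.Vec.Functional as Vector
open import Function.Base using (_∘_)
open import Level using (Level)
import Relation.Binary.Reasoning.Setoid as SetoidReasoning

module _ {c ℓ₁ ℓ₂ : Level} (K : HeytingField c ℓ₁ ℓ₂) where

  open OverField K
  open HeytingField K using (heytingCommutativeRing)
  open HeytingCommutativeRing heytingCommutativeRing using (_#_; #⇒invertible)
  open HeytingCommutativeRingProperties heytingCommutativeRing using (x-0≈x)
  open CommutativeRing (HeytingCommutativeRing.commutativeRing heytingCommutativeRing)
    hiding (zero)
  open CommutativeMonoidSum +-commutativeMonoid
    using (sum-syntax; sum-cong-≋; sum-replicate-zero; ∑-comm)
  open SemiringSum semiring using (*-distribˡ-sum; *-distribʳ-sum)
  open GroupProperties +-group using () renaming (∙-cancelʳ to +-cancelʳ)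
  open AlgebraDefinitions _≈_ using (Invertible; LeftInvertible)
  open LeftModuleMorphisms polyRawLeftModule (TensorUnit.rawLeftModule {R = rawRing})
    using (module IsLeftModuleHomomorphism)
  open SetoidReasoning setoid

  -- Inverses and cancellation in the field.

  #0⇒invertible : ∀ {x} → x # 0# → Invertible 1# _*_ x
  #0⇒invertible x#0 = let (y , yx≈1 , xy≈1) = #⇒invertible x#0 in
    y , trans (*-congˡ (sym (x-0≈x _))) yx≈1 , trans (*-congʳ (sym (x-0≈x _))) xy≈1

  leftInvertible⇒*-cancelˡ : ∀ {a x y} → LeftInvertible 1# _*_ a → a * x ≈ a * y → x ≈ y
  leftInvertible⇒*-cancelˡ {a} {x} {y} (b , ba≈1) ax≈ay = begin
    x           ≈⟨ undo x ⟨
    b * (a * x) ≈⟨ *-congˡ ax≈ay ⟩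
    b * (a * y) ≈⟨ undo y ⟩
    y           ∎
    where
    undo : ∀ z → b * (a * z) ≈ z
    undo z = trans (sym (*-assoc b a z)) (trans (*-congʳ ba≈1) (*-identityˡ z))

  -- Finite sums of sequences

  Σ< : ℕ → (ℕ → Carrier) → Carrier
  Σ< n f = ∑[ j < n ] f (toℕ j)

  Σ<-zero : ∀ n {f} → (∀ j → f j ≈ 0#) → Σ< n f ≈ 0#
  Σ<-zero n f≈0 = trans (sum-cong-≋ {n} (λ j → f≈0 (toℕ j))) (sum-replicate-zero n)

  -- Row widths are upper bounds chosen by the construction, so equal rows may carry different ones.
  -- This lemma exchanges one bound for another: the terms beyond either bound vanish.
  Σ<-support : ∀ m n (f : ℕ → Carrier) →
               (∀ j → m ≤ j → f j ≈ 0#) → (∀ j → n ≤ j → f j ≈ 0#) →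
               Σ< m f ≈ Σ< n f
  Σ<-support zero    n       f f≈0 _   = sym (Σ<-zero n (λ j → f≈0 j z≤n))
  Σ<-support (suc m) zero    f _   f≈0 = Σ<-zero (suc m) (λ j → f≈0 j z≤n)
  Σ<-support (suc m) (suc n) f vₘ  vₙ  = +-congˡ (Σ<-support m n (f ∘ suc)
    (λ j m≤j → vₘ (suc j) (s≤s m≤j)) (λ j n≤j → vₙ (suc j) (s≤s n≤j)))

  -- The side condition covers a column `k` outside the range of summation, where the sum is zero.
  Σ<-identityʳ : ∀ n k (f : ℕ → Carrier) → (n ≤ k → f k ≈ 0#) →
                 Σ< n (λ j → f j * entry identity j k) ≈ f k
  Σ<-identityʳ zero    k       f f≈0 = sym (f≈0 z≤n)
  Σ<-identityʳ (suc n) zero    f _   = begin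
    f 0 * 1# + Σ< n (λ j → f (suc j) * 0#) ≈⟨ +-cong (*-identityʳ _) (Σ<-zero n λ j → zeroʳ (f (suc j))) ⟩
    f 0 + 0#                               ≈⟨ +-identityʳ _ ⟩
    f 0                                    ∎
  Σ<-identityʳ (suc n) (suc k) f f≈0 = begin
    f 0 * 0# + Σ< n (λ j → f (suc j) * entry identity j k)
      ≈⟨ +-cong (zeroʳ _) (Σ<-identityʳ n k (f ∘ suc) (λ n≤k → f≈0 (s≤s n≤k))) ⟩
    0# + f (suc k)
      ≈⟨ +-identityˡ _ ⟩
    f (suc k) ∎

  Σ<-identityˡ : ∀ n (f : ℕ → Carrier) → Σ< (suc n) (λ j → entry identity n j * f j) ≈ f n
  Σ<-identityˡ zero    f = trans (+-identityʳ _) (*-identityˡ _)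
  Σ<-identityˡ (suc n) f = begin
    0# * f 0 + Σ< (suc n) (λ j → entry identity n j * f (suc j))
      ≈⟨ +-cong (zeroˡ _) (Σ<-identityˡ n (f ∘ suc)) ⟩
    0# + f (suc n)
      ≈⟨ +-identityˡ _ ⟩
    f (suc n) ∎

  -- Row-finite matrices

  ≤-maximum : ∀ {n} (f : Fin n → ℕ) i → f i ≤ Vector.foldr ℕ._⊔_ 0 f
  ≤-maximum f zero    = ℕ.m≤m⊔n _ _
  ≤-maximum f (suc i) = ℕ.≤-trans (≤-maximum (f ∘ suc) i) (ℕ.m≤n⊔m (f zero) _)

  -- Row `n` of a product depends on its left factor only through that factor's row `n`. The rowwise
  -- form serves inductions in which only the rows reached so far are known.
  ·-row-cong : ∀ M M′ N {n n′} → (∀ j → entry M n j ≈ entry M′ n′ j) →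
               ∀ k → entry (M · N) n k ≈ entry (M′ · N) n′ k
  ·-row-cong M M′ N {n} {n′} M≈M′ k = begin
    Σ< (width M n)   (λ j → entry M n j * entry N j k)
      ≈⟨ Σ<-support (width M n) (width M′ n′) (λ j → entry M n j * entry N j k)
           (λ j w≤j → trans (*-congʳ (vanishes M n j w≤j)) (zeroˡ _))
           (λ j w≤j → trans (*-congʳ (trans (M≈M′ j) (vanishes M′ n′ j w≤j))) (zeroˡ _)) ⟩
    Σ< (width M′ n′) (λ j → entry M n j * entry N j k)
      ≈⟨ sum-cong-≋ {width M′ n′} (λ j → *-congʳ (M≈M′ (toℕ j))) ⟩
    Σ< (width M′ n′) (λ j → entry M′ n′ j * entry N j k) ∎

  ·-congʳ : ∀ M M′ N → M ≈ᴹ M′ → M · N ≈ᴹ M′ · N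
  ·-congʳ M M′ N M≈M′ n = ·-row-cong M M′ N (M≈M′ n)

  ·-congˡ : ∀ M N N′ → N ≈ᴹ N′ → M · N ≈ᴹ M · N′
  ·-congˡ M N N′ N≈N′ n k = sum-cong-≋ {width M n} (λ j → *-congˡ (N≈N′ (toℕ j) k))

  ·-identityˡ : ∀ M → identity · M ≈ᴹ M
  ·-identityˡ M n k = Σ<-identityˡ n (λ j → entry M j k)

  ·-identityʳ : ∀ M → M · identity ≈ᴹ M
  ·-identityʳ M n k = Σ<-identityʳ (width M n) k (entry M n) (vanishes M n k)

  ·-assoc : ∀ M N P → (M · N) · P ≈ᴹ M · (N · P)
  ·-assoc M N P n k = begin
    ∑[ j < v ] (∑[ i < w ] (m i * b i j) * p j)
      ≈⟨ sum-cong-≋ {v} (λ j → *-distribʳ-sum {w} (p j) _) ⟩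
    ∑[ j < v ] ∑[ i < w ] (m i * b i j * p j)
      ≈⟨ ∑-comm {v} {w} _ ⟩
    ∑[ i < w ] ∑[ j < v ] (m i * b i j * p j)
      ≈⟨ sum-cong-≋ {w} (λ i → sum-cong-≋ {v} (λ j → *-assoc _ _ _)) ⟩
    ∑[ i < w ] ∑[ j < v ] (m i * (b i j * p j))
      ≈⟨ sum-cong-≋ {w} (λ i → *-distribˡ-sum {v} (m i) _) ⟨
    ∑[ i < w ] (m i * Σ< v (λ j → entry N (toℕ i) j * entry P j k))
      -- The left side sums every inner row up to the common bound `v`, the right side up to the
      -- width of that row of `N`; `v` is the maximum of these widths.
      ≈⟨ sum-cong-≋ {w} (λ i → *-congˡ (Σ<-support v (width N (toℕ i)) _
           (λ j v≤j → vanishing i j (ℕ.≤-trans (≤-maximum (width N ∘ toℕ) i) v≤j))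
           (vanishing i))) ⟩
    ∑[ i < w ] (m i * Σ< (width N (toℕ i)) (λ j → entry N (toℕ i) j * entry P j k)) ∎
    where
    w v : ℕ
    w = width M n
    v = width (M · N) n
    m : Fin w → Carrier
    m i = entry M n (toℕ i)
    b : Fin w → Fin v → Carrier
    b i j = entry N (toℕ i) (toℕ j)
    p : Fin v → Carrier
    p j = entry P (toℕ j) k
    vanishing : ∀ (i : Fin w) j → width N (toℕ i) ≤ j →
                entry N (toℕ i) j * entry P j k ≈ 0#
    vanishing i j w≤j = trans (*-congʳ (vanishes N (toℕ i) j w≤j)) (zeroˡ _)

  -- Products with the shift and Jacobi matrices.

  shift-· : ∀ M n k → entry (shift · M) n k ≈ entry M (suc n) k
  shift-· M n = ·-identityˡ M (suc n)

  ·-shift-zero : ∀ M n → entry (M · shift) n 0 ≈ 0#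
  ·-shift-zero M n = Σ<-zero (width M n) (λ j → zeroʳ (entry M n j))

  -- Deleting column 0 of `shift` leaves `identity` by computation. Dually, row `n` of `shift` is
  -- row `suc n` of `identity`, which gives `shift-·`.
  ·-shift-suc : ∀ M n k → entry (M · shift) n (suc k) ≈ entry M n k
  ·-shift-suc = ·-identityʳ

  prev : (ℕ → Carrier) → ℕ → Carrier
  prev f zero    = 0#
  prev f (suc n) = f n

  -- Deleting the first row and column of a Jacobi matrix leaves the one with all coefficient
  -- sequences shifted, which drives the induction. It starts at row 1, since row 0 has no `γ`
  -- entry.
  Σ<-jacobi-suc : ∀ α β γ n (f : ℕ → Carrier) →
    Σ< (3 ℕ.+ n) (λ j → entry (jacobi α β γ) (suc n) j * f j) ≈
    α (suc n) * f (2 ℕ.+ n) + β (suc n) * f (suc n) + γ (suc n) * f n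
  Σ<-jacobi-suc α β γ zero f = begin
    γ 1 * f 0 + (β 1 * f 1 + (α 1 * f 2 + 0#)) ≈⟨ +-congˡ (+-congˡ (+-identityʳ _)) ⟩
    γ 1 * f 0 + (β 1 * f 1 + α 1 * f 2)        ≈⟨ +-comm _ _ ⟩
    (β 1 * f 1 + α 1 * f 2) + γ 1 * f 0        ≈⟨ +-congʳ (+-comm _ _) ⟩
    α 1 * f 2 + β 1 * f 1 + γ 1 * f 0          ∎
  Σ<-jacobi-suc α β γ (suc n) f =
    trans (+-cong (zeroˡ _) (Σ<-jacobi-suc (α ∘ suc) (β ∘ suc) (γ ∘ suc) n (f ∘ suc)))
          (+-identityˡ _)

  jacobi-· : ∀ α β γ M n k →
    entry (jacobi α β γ · M) n k ≈
    α n * entry M (suc n) k + β n * entry M n k + γ n * prev (λ m → entry M m k) n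
  jacobi-· α β γ M zero k = begin
    β 0 * entry M 0 k + (α 0 * entry M 1 k + 0#)     ≈⟨ +-congˡ (+-identityʳ _) ⟩
    β 0 * entry M 0 k + α 0 * entry M 1 k            ≈⟨ +-comm _ _ ⟩
    α 0 * entry M 1 k + β 0 * entry M 0 k            ≈⟨ +-identityʳ _ ⟨
    α 0 * entry M 1 k + β 0 * entry M 0 k + 0#       ≈⟨ +-congˡ (zeroʳ _) ⟨
    α 0 * entry M 1 k + β 0 * entry M 0 k + γ 0 * 0# ∎
  jacobi-· α β γ M (suc n) k = Σ<-jacobi-suc α β γ n (λ j → entry M j k)

  -- Matrices commuting with the shift or with a Jacobi matrix.

  module _ (M : Matrix) (row₀ : ∀ k → entry M 0 k ≈ entry identity 0 k) where

    -- Row n of M S = S M expresses row n+1 of M as row n moved one column to the right, a recursion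
    -- that the identity also satisfies.
    commutes-shift⇒identity : M · shift ≈ᴹ shift · M → M ≈ᴹ identity
    commutes-shift⇒identity MS≈SM zero    k = row₀ k
    commutes-shift⇒identity MS≈SM (suc n) k = begin
      entry M (suc n) k            ≈⟨ shift-· M n k ⟨
      entry (shift · M) n k        ≈⟨ MS≈SM n k ⟨
      entry (M · shift) n k        ≈⟨ ·-row-cong M identity shift (commutes-shift⇒identity MS≈SM n) k ⟩
      entry (identity · shift) n k ≈⟨ ·-identityˡ shift n k ⟩
      entry identity (suc n) k     ∎

    -- Row n of J M = M J gives αₙ times row n+1 of M in terms of rows n and n-1. The identity
    -- commutes with J too, so it obeys the same recursion.
    commutes-jacobi⇒identity : ∀ {α β γ} → (∀ n → LeftInvertible 1# _*_ (α n)) →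
                               M · jacobi α β γ ≈ᴹ jacobi α β γ · M → M ≈ᴹ identity
    commutes-jacobi⇒identity {α} {β} {γ} α-inv MJ≈JM n = proj₁ (rows n)
      where
      J = jacobi α β γ

      Row : ℕ → Set ℓ₁
      Row n = ∀ k → entry M n k ≈ entry identity n k

      PrevRow : ℕ → Set ℓ₁
      PrevRow n = ∀ k → prev (λ m → entry M m k) n ≈ prev (λ m → entry identity m k) n

      step : ∀ n → Row n → PrevRow n → Row (suc n)
      step n row prevRow k = leftInvertible⇒*-cancelˡ (α-inv n)
        -- With rows n and n-1 already replaced by those of the identity, the `β` and `γ` terms
        -- agree on both sides and cancel, and then `α n` does.
        (+-cancelʳ _ _ _ (+-cancelʳ _ _ _ (begin
          α n * entry M (suc n) k + β n * entry identity n k + γ n * prev (λ m → entry identity m k) n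
            ≈⟨ +-cong (+-congˡ (*-congˡ (row k))) (*-congˡ (prevRow k)) ⟨
          α n * entry M (suc n) k + β n * entry M n k + γ n * prev (λ m → entry M m k) n
            ≈⟨ jacobi-· α β γ M n k ⟨
          entry (J · M) n k
            ≈⟨ MJ≈JM n k ⟨
          entry (M · J) n k
            ≈⟨ ·-row-cong M identity J row k ⟩
          entry (identity · J) n k
            ≈⟨ ·-identityˡ J n k ⟩
          entry J n k
            ≈⟨ ·-identityʳ J n k ⟨
          entry (J · identity) n k
            ≈⟨ jacobi-· α β γ identity n k ⟩
          α n * entry identity (suc n) k + β n * entry identity n k + γ n * prev (λ m → entry identity m k) n ∎)))

      -- The recursion reaches back two rows, so the induction carries a pair; at 0 both previous
      -- rows are zero by the definition of `prev`.
      rows : ∀ n → Row n × PrevRow n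
      rows zero    = row₀ , λ _ → refl
      rows (suc n) = let (row , prevRow) = rows n in step n row prevRow , row

  -- Polynomials

  coeff-+ₚ : ∀ q r k → coeff (q +ₚ r) k ≈ coeff q k + coeff r k
  coeff-+ₚ []      r       k       = sym (+-identityˡ _)
  coeff-+ₚ (a ∷ q) []      k       = sym (+-identityʳ _)
  coeff-+ₚ (a ∷ q) (b ∷ r) zero    = refl
  coeff-+ₚ (a ∷ q) (b ∷ r) (suc k) = coeff-+ₚ q r k

  coeff-• : ∀ a q k → coeff (a • q) k ≈ a * coeff q k
  coeff-• a []      k       = sym (zeroʳ a)
  coeff-• a (b ∷ q) zero    = refl
  coeff-• a (b ∷ q) (suc k) = coeff-• a q k

  -- Trailing zeros are allowed, so a zero or constant polynomial may be a long list. The two facts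
  -- are proved together: a constant has a zero tail, and a zero polynomial is a constant with value
  -- 0.
  ≈0ₚ⇒*ₚ≈0ₚ : ∀ q r → q ≈ₚ 0ₚ → q *ₚ r ≈ₚ 0ₚ
  constant-*ₚ : ∀ q r → (∀ k → coeff q (suc k) ≈ 0#) → q *ₚ r ≈ₚ coeff q 0 • r

  ≈0ₚ⇒*ₚ≈0ₚ q r q≈0 k = begin
    coeff (q *ₚ r) k        ≈⟨ constant-*ₚ q r (q≈0 ∘ suc) k ⟩
    coeff (coeff q 0 • r) k ≈⟨ coeff-• (coeff q 0) r k ⟩
    coeff q 0 * coeff r k   ≈⟨ *-congʳ (q≈0 0) ⟩
    0# * coeff r k          ≈⟨ zeroˡ _ ⟩
    0#                      ∎

  constant-*ₚ []      r _   k = sym (trans (coeff-• 0# r k) (zeroˡ _))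
  constant-*ₚ (a ∷ q) r q≈0 k = begin
    coeff (a • r +ₚ (0# ∷ q *ₚ r)) k            ≈⟨ coeff-+ₚ (a • r) _ k ⟩
    coeff (a • r) k + coeff (0# ∷ q *ₚ r) k     ≈⟨ +-congˡ (tail≈0 k) ⟩
    coeff (a • r) k + 0#                        ≈⟨ +-identityʳ _ ⟩
    coeff (a • r) k                             ∎
    where
    tail≈0 : ∀ k → coeff (0# ∷ q *ₚ r) k ≈ 0#
    tail≈0 zero    = refl
    tail≈0 (suc k) = ≈0ₚ⇒*ₚ≈0ₚ q r q≈0 k

  X*ₚ : ∀ q → X *ₚ q ≈ₚ 0# ∷ q
  X*ₚ q k = begin
    coeff (0# • q +ₚ (0# ∷ 1ₚ *ₚ q)) k          ≈⟨ coeff-+ₚ (0# • q) _ k ⟩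
    coeff (0# • q) k + coeff (0# ∷ 1ₚ *ₚ q) k   ≈⟨ +-cong (trans (coeff-• 0# q k) (zeroˡ _)) (shifted k) ⟩
    0# + coeff (0# ∷ q) k                       ≈⟨ +-identityˡ _ ⟩
    coeff (0# ∷ q) k                            ∎
    where
    shifted : ∀ k → coeff (0# ∷ 1ₚ *ₚ q) k ≈ coeff (0# ∷ q) k
    shifted zero    = refl
    shifted (suc k) = trans (constant-*ₚ 1ₚ q (λ _ → refl) k)
                            (trans (coeff-• 1# q k) (*-identityˡ _))

  coeff-X^ : ∀ n k → coeff (X^ n) k ≈ entry identity n k
  coeff-X^ zero    zero    = refl
  coeff-X^ zero    (suc k) = refl
  coeff-X^ (suc n) zero    = X*ₚ (X^ n) 0
  coeff-X^ (suc n) (suc k) = trans (X*ₚ (X^ n) (suc k)) (coeff-X^ n k)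

  -- The bridge between matrices and functionals: with `a` a row of a matrix and `q` the sequence
  -- `p`, the coefficients form a row of a product with the coefficient matrix, while a linear
  -- functional acts on it term by term.
  combination : ℕ → (ℕ → Carrier) → (ℕ → Poly) → Poly
  combination zero    a q = 0ₚ
  combination (suc n) a q = a 0 • q 0 +ₚ combination n (a ∘ suc) (q ∘ suc)

  coeff-combination : ∀ n a q k → coeff (combination n a q) k ≈ Σ< n (λ j → a j * coeff (q j) k)
  coeff-combination zero    a q k = refl
  coeff-combination (suc n) a q k = begin
    coeff (a 0 • q 0 +ₚ combination n (a ∘ suc) (q ∘ suc)) k
      ≈⟨ coeff-+ₚ (a 0 • q 0) _ k ⟩
    coeff (a 0 • q 0) k + coeff (combination n (a ∘ suc) (q ∘ suc)) k
      ≈⟨ +-cong (coeff-• (a 0) (q 0) k) (coeff-combination n (a ∘ suc) (q ∘ suc) k) ⟩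
    Σ< (suc n) (λ j → a j * coeff (q j) k) ∎

  module _ {L : Poly → Carrier} (linear : IsLinearFunctional L) where

    open IsLeftModuleHomomorphism linear

    linear-combination : ∀ n a q → L (combination n a q) ≈ Σ< n (λ j → a j * L (q j))
    linear-combination zero    a q = 0ᴹ-homo
    linear-combination (suc n) a q = begin
      L (a 0 • q 0 +ₚ combination n (a ∘ suc) (q ∘ suc))
        ≈⟨ +ᴹ-homo (a 0 • q 0) (combination n (a ∘ suc) (q ∘ suc)) ⟩
      L (a 0 • q 0) + L (combination n (a ∘ suc) (q ∘ suc))
        ≈⟨ +-cong (*ₗ-homo (a 0) (q 0)) (linear-combination n (a ∘ suc) (q ∘ suc)) ⟩
      Σ< (suc n) (λ j → a j * L (q j)) ∎

  -- Polynomial sequences satisfying a three-term recurrence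

  -- When u is inverse to a₀₀, row n lists the coordinates of xⁿ in the basis p.
  expansionEntry : (α β γ : ℕ → Carrier) → Carrier → ℕ → ℕ → Carrier
  expansionEntry α β γ u zero    k = u * entry identity 0 k
  expansionEntry α β γ u (suc n) k =
    Σ< (suc n) (λ j → expansionEntry α β γ u n j * entry (jacobi α β γ) j k)

  expansion : (α β γ : ℕ → Carrier) → Carrier → Matrix
  entry (expansion α β γ u) = expansionEntry α β γ u
  -- With this width, `vanishes` is exactly lower triangularity.
  width (expansion α β γ u) = suc
  vanishes (expansion α β γ u) zero    k 0<k = trans (*-congˡ (vanishes identity 0 k 0<k)) (zeroʳ _)
  -- Row `j` of the Jacobi matrix ends at column j+1, and here j ≤ n.
  vanishes (expansion α β γ u) (suc n) k n<k = trans
    (sum-cong-≋ {suc n} (λ j → trans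
      (*-congˡ (vanishes (jacobi α β γ) (toℕ j) k (ℕ.≤-trans (s≤s (toℕ<n j)) n<k)))
      (zeroʳ (expansionEntry α β γ u n (toℕ j)))))
    (sum-replicate-zero (suc n))

  -- Row n+1 of the expansion is by definition row n of its product with the Jacobi matrix; the
  -- summation bound `suc n` there equals the width of row n.
  shift-expansion : ∀ α β γ u →
    shift · expansion α β γ u ≈ᴹ expansion α β γ u · jacobi α β γ
  shift-expansion α β γ u = shift-· (expansion α β γ u)

  module _ (p : ℕ → Poly) (α β γ : ℕ → Carrier)
           (degree : ∀ n → HasDegree (p n) n)
           (recurrence : ThreeTermRecurrence α β γ p) where

    private
      A = coefficientMatrix p
      J = jacobi α β γ

    coeff-pred : ∀ n k → coeff (pred p n) k ≈ prev (λ m → coeff (p m) k) n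
    coeff-pred zero    k = refl
    coeff-pred (suc n) k = refl

    coeff-recurrence : ∀ n k →
      coeff (0# ∷ p n) k ≈
      α n * coeff (p (suc n)) k + β n * coeff (p n) k + γ n * prev (λ m → coeff (p m) k) n
    coeff-recurrence n k = begin
      coeff (0# ∷ p n) k
        ≈⟨ X*ₚ (p n) k ⟨
      coeff (X *ₚ p n) k
        ≈⟨ recurrence n k ⟩
      coeff (α n • p (suc n) +ₚ β n • p n +ₚ γ n • pred p n) k
        ≈⟨ trans (coeff-+ₚ (α n • p (suc n) +ₚ β n • p n) _ k) (+-congʳ (coeff-+ₚ (α n • p (suc n)) _ k)) ⟩
      coeff (α n • p (suc n)) k + coeff (β n • p n) k + coeff (γ n • pred p n) k
        ≈⟨ +-cong (+-cong (coeff-• (α n) (p (suc n)) k) (coeff-• (β n) (p n) k))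
                  (trans (coeff-• (γ n) (pred p n) k) (*-congˡ (coeff-pred n k))) ⟩
      α n * coeff (p (suc n)) k + β n * coeff (p n) k + γ n * prev (λ m → coeff (p m) k) n ∎

    -- Right multiplication by S moves coefficients one column to the right, that is, multiplies
    -- each polynomial by x.
    A·shift≈J·A : A · shift ≈ᴹ J · A
    A·shift≈J·A n k = begin
      entry (A · shift) n k ≈⟨ row k ⟩
      coeff (0# ∷ p n) k    ≈⟨ coeff-recurrence n k ⟩
      α n * coeff (p (suc n)) k + β n * coeff (p n) k + γ n * prev (λ m → coeff (p m) k) n
                            ≈⟨ jacobi-· α β γ A n k ⟨
      entry (J · A) n k     ∎
      where
      row : ∀ k → entry (A · shift) n k ≈ coeff (0# ∷ p n) k
      row zero    = ·-shift-zero A n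
      row (suc k) = ·-shift-suc A n k

    -- Compare coefficients of xⁿ⁺¹ in the recurrence: pₙ and pₙ₋₁ have degree too small to
    -- contribute.
    leading-recurrence : ∀ n → coeff (p n) n ≈ α n * coeff (p (suc n)) (suc n)
    leading-recurrence n = begin
      coeff (p n) n
        ≈⟨ coeff-recurrence n (suc n) ⟩
      α n * coeff (p (suc n)) (suc n) + β n * coeff (p n) (suc n) + γ n * prev (λ m → coeff (p m) (suc n)) n
        ≈⟨ +-cong (+-congˡ (*-congˡ (proj₂ (degree n) (suc n) ℕ.≤-refl))) (*-congˡ (prev≈0 n)) ⟩
      α n * coeff (p (suc n)) (suc n) + β n * 0# + γ n * 0#
        ≈⟨ +-cong (+-congˡ (zeroʳ _)) (zeroʳ _) ⟩
      α n * coeff (p (suc n)) (suc n) + 0# + 0#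
        ≈⟨ trans (+-identityʳ _) (+-identityʳ _) ⟩
      α n * coeff (p (suc n)) (suc n) ∎
      where
      prev≈0 : ∀ n → prev (λ m → coeff (p m) (suc n)) n ≈ 0#
      prev≈0 zero    = refl
      prev≈0 (suc n) = proj₂ (degree n) (2 ℕ.+ n) (ℕ.m<n⇒m<1+n ℕ.≤-refl)

    α-leftInvertible : ∀ n → LeftInvertible 1# _*_ (α n)
    α-leftInvertible n = let (b , ba≈1 , _) = #0⇒invertible (proj₁ (degree n)) in
      -- The inverse of αₙ is the ratio of leading coefficients aₙ₊₁,ₙ₊₁ / aₙₙ.
      b * coeff (p (suc n)) (suc n) , (begin
        b * coeff (p (suc n)) (suc n) * α n   ≈⟨ *-assoc _ _ _ ⟩
        b * (coeff (p (suc n)) (suc n) * α n) ≈⟨ *-congˡ (*-comm _ _) ⟩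
        b * (α n * coeff (p (suc n)) (suc n)) ≈⟨ *-congˡ (leading-recurrence n) ⟨
        b * coeff (p n) n                     ≈⟨ ba≈1 ⟩
        1#                                    ∎)

    coefficientMatrix-invertible : InvertibleLowerTriangular A
    coefficientMatrix-invertible = record
      { lowerTriangular         = λ n → proj₂ (degree n)
      ; inverse                 = B
      ; inverse-lowerTriangular = vanishes B
      ; inverseˡ                = commutes-shift⇒identity (B · A) BA-row₀ BA-commutes
      ; inverseʳ                = commutes-jacobi⇒identity (A · B) AB-row₀ α-leftInvertible AB-commutes
      }
      where
      a₀₀-invertible = #0⇒invertible (proj₁ (degree 0))

      u : Carrier
      u = proj₁ a₀₀-invertible

      B : Matrix
      B = expansion α β γ u

      BA-row₀ : ∀ k → entry (B · A) 0 k ≈ entry identity 0 k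
      BA-row₀ k = begin
        u * 1# * coeff (p 0) k + 0# ≈⟨ +-identityʳ _ ⟩
        u * 1# * coeff (p 0) k      ≈⟨ *-congʳ (*-identityʳ u) ⟩
        u * coeff (p 0) k           ≈⟨ row k ⟩
        entry identity 0 k          ∎
        where
        row : ∀ k → u * coeff (p 0) k ≈ entry identity 0 k
        row zero    = proj₁ (proj₂ a₀₀-invertible)
        row (suc k) = trans (*-congˡ (proj₂ (degree 0) (suc k) (s≤s z≤n))) (zeroʳ u)

      AB-row₀ : ∀ k → entry (A · B) 0 k ≈ entry identity 0 k
      AB-row₀ k = begin
        Σ< (width A 0) (λ j → entry A 0 j * entry B j k)
          -- The list `p 0` may be long, but its degree is 0, so only the term j = 0 survives.
          ≈⟨ Σ<-support (width A 0) 1 (λ j → entry A 0 j * entry B j k)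
               (λ j w≤j → trans (*-congʳ (vanishes A 0 j w≤j)) (zeroˡ _))
               (λ j 0<j → trans (*-congʳ (proj₂ (degree 0) j 0<j)) (zeroˡ _)) ⟩
        coeff (p 0) 0 * (u * entry identity 0 k) + 0#
          ≈⟨ +-identityʳ _ ⟩
        coeff (p 0) 0 * (u * entry identity 0 k)
          ≈⟨ *-assoc _ _ _ ⟨
        coeff (p 0) 0 * u * entry identity 0 k
          ≈⟨ *-congʳ (proj₂ (proj₂ a₀₀-invertible)) ⟩
        1# * entry identity 0 k
          ≈⟨ *-identityˡ _ ⟩
        entry identity 0 k ∎

      BA-commutes : (B · A) · shift ≈ᴹ shift · (B · A)
      BA-commutes n k = begin
        entry ((B · A) · shift) n k ≈⟨ ·-assoc B A shift n k ⟩
        entry (B · (A · shift)) n k ≈⟨ ·-congˡ B (A · shift) (J · A) A·shift≈J·A n k ⟩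
        entry (B · (J · A)) n k     ≈⟨ ·-assoc B J A n k ⟨
        entry ((B · J) · A) n k     ≈⟨ ·-congʳ (shift · B) (B · J) A (shift-expansion α β γ u) n k ⟨
        entry ((shift · B) · A) n k ≈⟨ ·-assoc shift B A n k ⟩
        entry (shift · (B · A)) n k ∎

      AB-commutes : (A · B) · J ≈ᴹ J · (A · B)
      AB-commutes n k = begin
        entry ((A · B) · J) n k     ≈⟨ ·-assoc A B J n k ⟩
        entry (A · (B · J)) n k     ≈⟨ ·-congˡ A (shift · B) (B · J) (shift-expansion α β γ u) n k ⟨
        entry (A · (shift · B)) n k ≈⟨ ·-assoc A shift B n k ⟨
        entry ((A · shift) · B) n k ≈⟨ ·-congʳ (A · shift) (J · A) B A·shift≈J·A n k ⟩
        entry ((J · A) · B) n k     ≈⟨ ·-assoc J A B n k ⟩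
        entry (J · (A · B)) n k     ∎

    -- The inverse stored in `inverse-invertible A⁻¹` is `A` itself, so the production matrix
    -- unfolds to `A · (shift · C)`.
    production≈jacobi : (A⁻¹ : InvertibleLowerTriangular A) →
                        productionMatrix (inverse-invertible A⁻¹) ≈ᴹ J
    production≈jacobi A⁻¹ n k = begin
      entry (A · (shift · C)) n k ≈⟨ ·-assoc A shift C n k ⟨
      entry ((A · shift) · C) n k ≈⟨ ·-congʳ (A · shift) (J · A) C A·shift≈J·A n k ⟩
      entry ((J · A) · C) n k     ≈⟨ ·-assoc J A C n k ⟩
      entry (J · (A · C)) n k     ≈⟨ ·-congˡ J (A · C) identity inverseʳ n k ⟩
      entry (J · identity) n k    ≈⟨ ·-identityʳ J n k ⟩
      entry J n k                 ∎
      where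
      C = inverse A⁻¹
      open InvertibleLowerTriangular A⁻¹ using (inverseʳ)

  -- The orthogonality functional and its moments.

  module _ {p : ℕ → Poly} (degree₀ : HasDegree (p 0) 0)
           {L : Poly → Carrier} (isOrthogonal : IsOrthogonalWrt L p)
           (Lp₀≈1 : L (p 0) ≈ 1#) where

    open IsOrthogonalWrt isOrthogonal
    open IsLeftModuleHomomorphism linear

    -- Writing the values as column 0 of the identity lets summation against them pick out the first
    -- column of a matrix.
    functional-basis : ∀ j → L (p j) ≈ entry identity j 0
    functional-basis zero    = Lp₀≈1
    functional-basis (suc j) = leftInvertible⇒*-cancelˡ
      (let (b , ba≈1 , _) = #0⇒invertible (proj₁ degree₀) in b , ba≈1) (begin
        coeff (p 0) 0 * L (p (suc j))
          ≈⟨ *ₗ-homo (coeff (p 0) 0) (p (suc j)) ⟨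
        L (coeff (p 0) 0 • p (suc j))
          -- Since p₀ is the constant a₀₀, scaling by a₀₀ is multiplication by p₀, and orthogonality
          -- applies.
          ≈⟨ ⟦⟧-cong (constant-*ₚ (p 0) (p (suc j)) (λ k → proj₂ degree₀ (suc k) (s≤s z≤n))) ⟨
        L (p 0 *ₚ p (suc j))
          ≈⟨ orthogonal 0 (suc j) (λ ()) ⟩
        0#
          ≈⟨ zeroʳ _ ⟨
        coeff (p 0) 0 * 0# ∎)

    inverse-firstColumn : (A⁻¹ : InvertibleLowerTriangular (coefficientMatrix p)) →
                          ∀ n → entry (inverse A⁻¹) n 0 ≈ moment L n
    inverse-firstColumn A⁻¹ n = begin
      entry C n 0
        ≈⟨ ·-identityʳ C n 0 ⟨
      Σ< w (λ j → entry C n j * entry identity j 0)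
        ≈⟨ sum-cong-≋ {w} (λ j → *-congˡ (functional-basis (toℕ j))) ⟨
      Σ< w (λ j → entry C n j * L (p j))
        ≈⟨ linear-combination linear w (entry C n) p ⟨
      L (combination w (entry C n) p)
        ≈⟨ ⟦⟧-cong X^-expansion ⟨
      L (X^ n) ∎
      where
      C = inverse A⁻¹
      w = width C n
      open InvertibleLowerTriangular A⁻¹ using (inverseˡ)

      -- Row n of C A = 1, read as an identity of polynomials.
      X^-expansion : X^ n ≈ₚ combination w (entry C n) p
      X^-expansion k = begin
        coeff (X^ n) k                          ≈⟨ coeff-X^ n k ⟩
        entry identity n k                      ≈⟨ inverseˡ n k ⟨
        entry (C · coefficientMatrix p) n k     ≈⟨ coeff-combination w (entry C n) p k ⟨
        coeff (combination w (entry C n) p) k   ∎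

theorem4p4 :
    ∀ {c ℓ₁ ℓ₂} (K : HeytingField c ℓ₁ ℓ₂) →
    let open HeytingField K
        open OverField K
    in
    (p : ℕ → Poly) (α β γ : ℕ → Carrier) →
    IsOPS p →
    (∀ n → coeff (p n) n # 0#) →
    ThreeTermRecurrence α β γ p →
    let A = coefficientMatrix p in
    InvertibleLowerTriangular A ×
    ((A⁻¹ : InvertibleLowerTriangular A) →
      (productionMatrix (inverse-invertible A⁻¹) ≈ᴹ jacobi α β γ) ×
      ((L : Poly → Carrier) → IsOrthogonalWrt L p → L (p 0) ≈ 1# →
        ∀ n → entry (inverse A⁻¹) n 0 ≈ moment L n))
theorem4p4 K p α β γ isOPS _ recurrence =
  coefficientMatrix-invertible K p α β γ degree recurrence ,
  λ A⁻¹ →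
    production≈jacobi K p α β γ degree recurrence A⁻¹ ,
    λ L isOrthogonal Lp₀≈1 → inverse-firstColumn K (degree 0) isOrthogonal Lp₀≈1 A⁻¹
  where open OverField.IsOPS isOPS using (degree)
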